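{- Let $f:\{0,1\}^5\to\{0,1\}$ be a radius-$2$ cellular automaton local rule with induced global rule $F$. For $L\ge5$ let $$E_L=\begin{cases}\{1^L\}, & L\text{ odd};\\ \{1^L,(10)^{L/2},(01)^{L/2}\}, & L=4p+2\text{ for some integer }p\ge1;\\ \{1^L,(10)^{L/2},(01)^{L/2},(1100)^{L/4},(1001)^{L/4},(0011)^{L/4},(0110)^{L/4}\}, & L=4p\text{ for some integer }p\ge2.\end{cases}$$ Suppose there are integers $n_1\ge1$ and $n_2\ge1$ such that the following properties hold for every $L\ge5$: C1) for every $c\in\mathscr{C}_L$ with $c\notin E_L$ there is $0\le j\le L-1$ with $(F^{n_1}(c))_{[j,j+2]}=000$; C2) there is $0\le i\le L-1$ such that, for every $c\in\mathscr{C}_L$ and every $0\le j\le L-1$, if $c_{[j,j+2]}=000$ then $(F^{n_2}(c))_{[i+j,i+j+3]}=0000$; C3) $f(0,1,0,1,0)=f(1,0,1,0,1)=f(1,1,1,1,1)=f(1,1,0,0,1)=f(0,0,1,1,0)=1$; C4) $f(0,0,0,0,0)=f(0,1,1,0,0)=f(1,0,0,1,1)=0$. Then $f$ is a consensus rule and $\mathscr{B}_1^L=E_L$ for every $L\ge5$.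
   Context: A radius-$2$ (binary, one-dimensional) cellular automaton local rule is a function $f:\{0,1\}^{5}\to\{0,1\}$. A configuration of length $L$ is a cyclic word $c=(c_0,\dots,c_{L-1})\in\{0,1\}^L=:\mathscr{C}_L$, with cell indices taken modulo $L$; $c_{[a,b]}=c_ac_{a+1}\cdots c_b$. The induced global rule $F:\mathscr{C}_L\to\mathscr{C}_L$ is $(F(c))_p=f(c_{p-2},c_{p-1},c_p,c_{p+1},c_{p+2})$, and $F^n$ is its $n$-th iterate. For a block $b$, $b^n$ denotes the concatenation of $n$ copies of $b$. An attractor of length $L$ of $F$ is a nonempty set $X\subseteq\mathscr{C}_L$ with $F(X)=X$ such that any nonempty $Y\subseteq X$ with $F(Y)=Y$ equals $X$ (i.e. a periodic orbit); if $X=\{x\}$ it is a fixed point and is identified with $x$. The basin of attraction of $X$ is $\{c\in\mathscr{C}_L: F^t(c)\in X\text{ for some }t\ge0\}$; $\mathscr{B}^L_x$ denotes the basin of attraction of $x^L$ for $x\in\{0,1\}$. The rule $f$ is a consensus rule if for every $L\ge5$ its only attractors of length $L$ are $0^L$ and $1^L$ (both being attractors). -}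

module Defs where

open import Data.Digit using (Bit; 0b; 1b)
open import Data.Fin.Base using (Fin; toℕ)
open import Data.Fin.Properties using (nonZeroIndex)
open import Data.List.Base as List using (List; []; _∷_)
open import Data.List.Membership.Propositional using () renaming (_∈_ to _∈ˡ_)
open import Data.Nat.Base using (ℕ; _+_; _*_; _∸_; _≤_; _/_)
open import Data.Nat.Divisibility using (_∤_)
open import Data.Nat.DivMod using (_mod_)
open import Data.Nat.GeneralisedArithmetic using (iterate)
open import Data.Product.Base using (∃-syntax; _×_)
open import Data.Sum.Base using (_⊎_)
open import Data.Vec.Base using (Vec; lookup; tabulate; replicate; toList)
open import Level using (0ℓ; suc)
open import Relation.Binary.PropositionalEquality.Core using (_≡_)
open import Relation.Unary using (Pred; _∈_; _⊆_; _≐_; ｛_｝; Satisfiable)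

Rule : Set
Rule = Bit → Bit → Bit → Bit → Bit → Bit

Config : ℕ → Set
Config L = Vec Bit L

infixl 6 _⊕_ _⊖_

_⊕_ : ∀ {L} → Fin L → ℕ → Fin L
_⊕_ {L} p k = _mod_ (toℕ p + k) L {{nonZeroIndex p}}

-- Subtraction modulo L.  Because ∸ truncates, this is correct only for
-- k ≤ L (or L = 1); it is used below with k ≤ 2.
_⊖_ : ∀ {L} → Fin L → ℕ → Fin L
_⊖_ {L} p k = p ⊕ (L ∸ k)

-- block c j n is the cyclic block c_{[j , j+n-1]} of n cells.
block : ∀ {L} → Config L → Fin L → (n : ℕ) → Vec Bit n
block c j n = tabulate λ k → lookup c (j ⊕ toℕ k)

global : Rule → ∀ {L} → Config L → Config L
global f c = tabulate λ p →
  f (lookup c (p ⊖ 2)) (lookup c (p ⊖ 1)) (lookup c p)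
    (lookup c (p ⊕ 1)) (lookup c (p ⊕ 2))

Image : {A : Set} → (A → A) → Pred A 0ℓ → Pred A 0ℓ
Image F X y = ∃[ x ] x ∈ X × F x ≡ y

record IsAttractor {A : Set} (F : A → A) (X : Pred A 0ℓ) : Set (suc 0ℓ) where
  field
    nonempty  : Satisfiable X
    invariant : Image F X ≐ X
    minimal   : ∀ (Y : Pred A 0ℓ) → Satisfiable Y → Y ⊆ X → Image F Y ≐ Y → Y ≐ X

Basin : {A : Set} → (A → A) → Pred A 0ℓ → Pred A 0ℓ
Basin F X c = ∃[ t ] iterate F c t ∈ X

𝓑 : Rule → (L : ℕ) → Bit → Pred (Config L) 0ℓ
𝓑 f L x = Basin (global f) ｛ replicate L x ｝

IsConsensus : Rule → Set (suc 0ℓ)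
IsConsensus f = ∀ L → 5 ≤ L →
  IsAttractor (global f) ｛ replicate L 0b ｝ ×
  IsAttractor (global f) ｛ replicate L 1b ｝ ×
  (∀ (X : Pred (Config L) 0ℓ) → IsAttractor (global f) X →
     X ≐ ｛ replicate L 0b ｝ ⊎ X ≐ ｛ replicate L 1b ｝)

_^_ : List Bit → ℕ → List Bit
b ^ n = List.concat (List.replicate n b)

-- The three alternatives are mutually exclusive and, for L ≥ 5, exhaustive.
E : (L : ℕ) → Pred (Config L) 0ℓ
E L c =
  (2 ∤ L × toList c ∈ˡ (1ᴸ ∷ []))
  ⊎ (∃[ p ] 1 ≤ p × L ≡ 4 * p + 2 × toList c ∈ˡ
      ( 1ᴸ
      ∷ (1b ∷ 0b ∷ []) ^ (L / 2)
      ∷ (0b ∷ 1b ∷ []) ^ (L / 2)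
      ∷ []))
  ⊎ (∃[ p ] 2 ≤ p × L ≡ 4 * p × toList c ∈ˡ
      ( 1ᴸ
      ∷ (1b ∷ 0b ∷ []) ^ (L / 2)
      ∷ (0b ∷ 1b ∷ []) ^ (L / 2)
      ∷ (1b ∷ 1b ∷ 0b ∷ 0b ∷ []) ^ (L / 4)
      ∷ (1b ∷ 0b ∷ 0b ∷ 1b ∷ []) ^ (L / 4)
      ∷ (0b ∷ 0b ∷ 1b ∷ 1b ∷ []) ^ (L / 4)
      ∷ (0b ∷ 1b ∷ 1b ∷ 0b ∷ []) ^ (L / 4)
      ∷ []))
  where
  1ᴸ : List Bit
  1ᴸ = (1b ∷ []) ^ L

{-# OPTIONS --safe #-}

-- By C2 a run of at least three zeros gains one cell every n₂ steps, so after
-- enough steps it covers the whole cycle.  With C1, every configuration outside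
-- E reaches 0ᴸ.  By C3 and C4 the 4-periodic words of E satisfy
-- (1100) ↦ (10) ↦ (1), up to rotation, so those in E reach 1ᴸ.  Hence the two
-- basins are E and its complement, and no other attractor has room.
module Submission where

open import Defs
open import Data.Digit using (Bit; 0b; 1b)
open import Data.Fin.Base using (Fin; toℕ; fromℕ<)
open import Data.Fin.Properties using (toℕ-fromℕ<; toℕ-injective; toℕ<n; toℕ≤n) renaming (_≟_ to _≟ᶠ_)
open import Data.List.Base as List using (List)
open import Data.List.Properties using (∷-injective; ≡-dec)
open import Data.List.Relation.Unary.Any using (here; there)
open import Data.Nat.Base using (ℕ; zero; suc; _+_; _*_; _∸_; _≤_; _<_; _%_; _/_; NonZero; z≤n; s≤s; s≤s⁻¹)
open import Data.Nat.Divisibility using (_∣?_)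
open import Data.Nat.DivMod
open import Data.Nat.GeneralisedArithmetic using (iterate)
open import Data.Nat.Properties
open import Data.Nat.Tactic.RingSolver using (solve-∀)
open import Data.Product.Base using (∃-syntax; _×_; _,_; proj₁; proj₂; swap)
open import Data.Sum.Base using (_⊎_; inj₁; inj₂)
open import Data.Vec.Base using (_∷_; []; lookup; tabulate; replicate; toList)
open import Data.Vec.Properties using (lookup∘tabulate; tabulate∘lookup; tabulate-cong; lookup-replicate)
open import Function.Base using (_∘_)
open import Level using (0ℓ)
open import Relation.Binary.PropositionalEquality
open import Relation.Nullary using (Dec; yes; no; ¬?; contradiction; _×-dec_; _⊎-dec_; map′)
open import Relation.Unary using (Pred; _∈_; _∉_; _⊆_; _≐_; ｛_｝)
open import Data.List.Membership.DecPropositional (≡-dec (_≟ᶠ_ {2})) using (_∈?_)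

private
  variable
    A : Set
    F : A → A
    X : Pred A 0ℓ
    L : ℕ

-- Iterates, basins and attractors

iterate-+ : ∀ (F : A → A) x m n → iterate F x (m + n) ≡ iterate F (iterate F x m) n
iterate-+ F x zero    n = refl
iterate-+ F x (suc m) n = iterate-+ F (F x) m n

iterate-fixed : ∀ {x} → F x ≡ x → ∀ n → iterate F x n ≡ x
iterate-fixed         Fx≡x zero    = refl
iterate-fixed {F = F} Fx≡x (suc n) = trans (cong (λ y → iterate F y n) Fx≡x) (iterate-fixed Fx≡x n)

iterate-closed : Image F X ⊆ X → ∀ n {x} → x ∈ X → iterate F x n ∈ X
iterate-closed closed zero    x∈X = x∈X
iterate-closed closed (suc n) x∈X = iterate-closed closed n (closed (_ , x∈X , refl))

basin-iterate : ∀ (F : A → A) X n c → Basin F X (iterate F c n) → Basin F X c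
basin-iterate F X n c (t , p) = n + t , subst X (sym (iterate-+ F c n t)) p

-- Once an orbit hits a fixed point it stays there. At time `s + t` the orbit of `c` has hit both
-- points, so they coincide.
basins-disjoint : ∀ {x y c} → F x ≡ x → F y ≡ y →
                  Basin F ｛ x ｝ c → Basin F ｛ y ｝ c → x ≡ y
basins-disjoint {F = F} {x} {y} {c} Fx≡x Fy≡y (s , x≡) (t , y≡) = begin
  x                            ≡⟨ settled Fx≡x s x≡ t ⟨
  iterate F c (s + t)          ≡⟨ cong (iterate F c) (+-comm s t) ⟩
  iterate F c (t + s)          ≡⟨ settled Fy≡y t y≡ s ⟩
  y                            ∎
  where
  open ≡-Reasoning
  settled : ∀ {z} → F z ≡ z → ∀ m → z ≡ iterate F c m → ∀ n → iterate F c (m + n) ≡ z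
  settled Fz≡z m z≡ n = trans (iterate-+ F c m n)
    (trans (cong (λ u → iterate F u n) (sym z≡)) (iterate-fixed Fz≡z n))

image-fixed : ∀ {x} → F x ≡ x → Image F ｛ x ｝ ≐ ｛ x ｝
image-fixed Fx≡x = (λ { (_ , refl , refl) → sym Fx≡x }) , (λ { refl → _ , refl , Fx≡x })

fixed⇒attractor : ∀ {x} → F x ≡ x → IsAttractor F ｛ x ｝
fixed⇒attractor Fx≡x = record
  { nonempty  = _ , refl
  ; invariant = image-fixed Fx≡x
  ; minimal   = λ Y (y , y∈Y) Y⊆X _ → Y⊆X , (λ { refl → subst Y (sym (Y⊆X y∈Y)) y∈Y })
  }

-- An attractor is closed under `F`, so the orbit of `c` stays in `X` and carries `x` into it. Then
-- ｛ x ｝ is a nonempty invariant subset of `X`, and minimality forces equality.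
attractor-meets-basin : ∀ {x c} → IsAttractor F X → F x ≡ x → c ∈ X → Basin F ｛ x ｝ c →
                        X ≐ ｛ x ｝
attractor-meets-basin {X = X} att Fx≡x c∈X (t , x≡) =
  swap (minimal _ (_ , refl) (λ { refl → x∈X }) (image-fixed Fx≡x))
  where
  open IsAttractor att
  x∈X = subst X (sym x≡) (iterate-closed (proj₁ invariant) t c∈X)

-- Arithmetic of cell indices

%-absorbˡ : ∀ m n d .{{_ : NonZero d}} → (m % d + n) % d ≡ (m + n) % d
%-absorbˡ m n d = begin
  (m % d + n) % d         ≡⟨ %-distribˡ-+ (m % d) n d ⟩
  (m % d % d + n % d) % d ≡⟨ cong (λ k → (k + n % d) % d) (m%n%n≡m%n m d) ⟩
  (m % d + n % d) % d     ≡⟨ %-distribˡ-+ m n d ⟨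
  (m + n) % d             ∎
  where open ≡-Reasoning

toℕ-⊕ : ∀ (p : Fin (suc L)) k → toℕ (p ⊕ k) ≡ (toℕ p + k) % suc L
toℕ-⊕ p k = toℕ-fromℕ< (m%n<n (toℕ p + k) _)

-- The later offset is put first so that, when `l` is a numeral, `l + k` computes to successors of
-- `k`; the growth argument relies on this.
⊕-⊕ : ∀ (p : Fin L) k l → (p ⊕ k) ⊕ l ≡ p ⊕ (l + k)
⊕-⊕ {L = suc L} p k l = toℕ-injective (begin
  toℕ ((p ⊕ k) ⊕ l)                   ≡⟨ toℕ-⊕ (p ⊕ k) l ⟩
  (toℕ (p ⊕ k) + l) % suc L           ≡⟨ cong (λ n → (n + l) % suc L) (toℕ-⊕ p k) ⟩
  ((toℕ p + k) % suc L + l) % suc L   ≡⟨ %-absorbˡ (toℕ p + k) l (suc L) ⟩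
  (toℕ p + k + l) % suc L             ≡⟨ cong (_% suc L) (trans (+-assoc (toℕ p) k l) (cong (toℕ p +_) (+-comm k l))) ⟩
  (toℕ p + (l + k)) % suc L           ≡⟨ toℕ-⊕ p (l + k) ⟨
  toℕ (p ⊕ (l + k))                   ∎)
  where open ≡-Reasoning

-- Displacing by `i` commutes with moving along the cycle. Hence the images of consecutive windows
-- under C2 are again consecutive.
⊕-toℕ-⊕ : ∀ (i j : Fin L) k → i ⊕ toℕ (j ⊕ k) ≡ (i ⊕ toℕ j) ⊕ k
⊕-toℕ-⊕ {L = suc L} i j k = toℕ-injective (begin
  toℕ (i ⊕ toℕ (j ⊕ k))               ≡⟨ toℕ-⊕ i (toℕ (j ⊕ k)) ⟩
  (toℕ i + toℕ (j ⊕ k)) % suc L       ≡⟨ cong (_% suc L) (trans (cong (toℕ i +_) (toℕ-⊕ j k)) (+-comm (toℕ i) _)) ⟩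
  ((toℕ j + k) % suc L + toℕ i) % suc L ≡⟨ %-absorbˡ (toℕ j + k) (toℕ i) (suc L) ⟩
  (toℕ j + k + toℕ i) % suc L         ≡⟨ cong (_% suc L) (rotate (toℕ i) (toℕ j) k) ⟩
  (toℕ i + (k + toℕ j)) % suc L       ≡⟨ toℕ-⊕ i (k + toℕ j) ⟨
  toℕ (i ⊕ (k + toℕ j))               ≡⟨ cong toℕ (⊕-⊕ i (toℕ j) k) ⟨
  toℕ ((i ⊕ toℕ j) ⊕ k)               ∎)
  where
  open ≡-Reasoning
  rotate : ∀ i j k → j + k + i ≡ i + (k + j)
  rotate = solve-∀

-- The offset from `j` to `p` goes once past the origin and is left unreduced: this avoids comparing
-- `j` with `p`, at the price of the bound `L + L` instead of `L`.
⊕-covers : ∀ (j p : Fin L) → j ⊕ ((L ∸ toℕ j) + toℕ p) ≡ p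
⊕-covers {L = suc L} j p = toℕ-injective (begin
  toℕ (j ⊕ ((suc L ∸ toℕ j) + toℕ p))             ≡⟨ toℕ-⊕ j _ ⟩
  (toℕ j + ((suc L ∸ toℕ j) + toℕ p)) % suc L     ≡⟨ cong (_% suc L) (+-assoc (toℕ j) _ (toℕ p)) ⟨
  (toℕ j + (suc L ∸ toℕ j) + toℕ p) % suc L       ≡⟨ cong (λ n → (n + toℕ p) % suc L) (m+[n∸m]≡n (toℕ≤n j)) ⟩
  (suc L + toℕ p) % suc L                         ≡⟨ cong (_% suc L) (+-comm (suc L) (toℕ p)) ⟩
  (toℕ p + suc L) % suc L                         ≡⟨ [m+n]%n≡m%n (toℕ p) (suc L) ⟩
  toℕ p % suc L                                   ≡⟨ m<n⇒m%n≡m (toℕ<n p) ⟩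
  toℕ p                                           ∎)
  where open ≡-Reasoning

-- Growth of runs of zeros

-- The length `k` may exceed `L`, the run then winding around the cycle, so growth needs no separate
-- case for a full cycle.
Zeros : Config L → Fin L → ℕ → Set
Zeros c j k = ∀ m → m < k → lookup c (j ⊕ m) ≡ 0b

block⇒zeros : ∀ (c : Config L) j k → block c j k ≡ replicate k 0b → Zeros c j k
block⇒zeros c j k eq m m<k = begin
  lookup c (j ⊕ m)                  ≡⟨ cong (λ n → lookup c (j ⊕ n)) (toℕ-fromℕ< m<k) ⟨
  lookup c (j ⊕ toℕ (fromℕ< m<k))   ≡⟨ lookup∘tabulate _ (fromℕ< m<k) ⟨
  lookup (block c j k) (fromℕ< m<k) ≡⟨ cong (λ b → lookup b (fromℕ< m<k)) eq ⟩
  lookup (replicate k 0b) (fromℕ< m<k) ≡⟨ lookup-replicate (fromℕ< m<k) 0b ⟩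
  0b                                ∎
  where open ≡-Reasoning

tabulate-const : ∀ {n} {g : Fin n → A} {x} → (∀ k → g k ≡ x) → tabulate g ≡ replicate n x
tabulate-const {x = x} g≡x =
  trans (tabulate-cong (λ k → trans (g≡x k) (sym (lookup-replicate k x)))) (tabulate∘lookup _)

zeros⇒block : ∀ (c : Config L) j k → Zeros c j k → block c j k ≡ replicate k 0b
zeros⇒block c j k z = tabulate-const (λ m → z (toℕ m) (toℕ<n m))

-- This is C2 for a fixed length, with `G` standing for the `n₂`-th iterate. The displacement `i`
-- depends neither on `c` nor on `j`, so all windows of a run move together.
Widens : (Config L → Config L) → Fin L → Set
Widens G i = ∀ c j → block c j 3 ≡ replicate 3 0b → block (G c) (i ⊕ toℕ j) 4 ≡ replicate 4 0b

-- A run of `3 + k` zeros contains the windows of length 3 at offsets 0 to `k`. Their images are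
-- blocks of length 4 at the same offsets from `i ⊕ toℕ j`, and together these cover `4 + k` cells.
widen : ∀ (G : Config L → Config L) {i} → Widens G i →
        ∀ c j k → Zeros c j (3 + k) → Zeros (G c) (i ⊕ toℕ j) (4 + k)
-- The first three cells come from the image of the window at offset 0. Cell `3 + a` is the last
-- cell of the image of the window at offset `a`.
widen G {i} widens c j k z = λ
  { 0 _ → from 0 z≤n 0 (s≤s z≤n)
  ; 1 _ → from 0 z≤n 1 (s≤s (s≤s z≤n))
  ; 2 _ → from 0 z≤n 2 (s≤s (s≤s (s≤s z≤n)))
  ; (suc (suc (suc a))) (s≤s (s≤s (s≤s a≤k))) → from a (s≤s⁻¹ a≤k) 3 ≤-refl
  }
  where
  window : ∀ a → a ≤ k → Zeros c (j ⊕ a) 3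
  window a a≤k b b<3 = trans (cong (lookup c) (⊕-⊕ j a b)) (z (b + a) (+-mono-<-≤ b<3 a≤k))

  from : ∀ a → a ≤ k → ∀ b → b < 4 → lookup (G c) ((i ⊕ toℕ j) ⊕ (b + a)) ≡ 0b
  from a a≤k b b<4 = begin
    lookup (G c) ((i ⊕ toℕ j) ⊕ (b + a)) ≡⟨ cong (lookup (G c)) (⊕-⊕ (i ⊕ toℕ j) a b) ⟨
    lookup (G c) (((i ⊕ toℕ j) ⊕ a) ⊕ b) ≡⟨ cong (λ p → lookup (G c) (p ⊕ b)) (⊕-toℕ-⊕ i j a) ⟨
    lookup (G c) ((i ⊕ toℕ (j ⊕ a)) ⊕ b) ≡⟨ block⇒zeros (G c) _ 4
                                              (widens c (j ⊕ a) (zeros⇒block c (j ⊕ a) 3 (window a a≤k))) b b<4 ⟩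
    0b                                   ∎
    where open ≡-Reasoning

widen-iterate : ∀ (G : Config L → Config L) {i} → Widens G i →
                ∀ n c j k → Zeros c j (3 + k) → ∃[ j′ ] Zeros (iterate G c n) j′ (3 + (n + k))
widen-iterate G     widens zero    c j k z = j , z
widen-iterate G {i} widens (suc n) c j k z
  with widen-iterate G widens n (G c) (i ⊕ toℕ j) (suc k) (widen G widens c j k z)
... | j′ , z′ = j′ , subst (λ m → Zeros (iterate G (G c) n) j′ (3 + m)) (+-suc n k) z′

zeros-everywhere : ∀ (c : Config L) j {k} → L + L ≤ k → Zeros c j k → c ≡ replicate L 0b
zeros-everywhere {L} c j L+L≤k z = trans (sym (tabulate∘lookup c)) (tabulate-const λ p →
  trans (cong (lookup c) (sym (⊕-covers j p)))
        (z _ (<-≤-trans (+-mono-≤-< (m∸n≤m L (toℕ j)) (toℕ<n p)) L+L≤k)))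

-- Growth is counted in steps of the `n`-th iterate, whereas `Basin` counts steps of `F`.
iterate-iterate : ∀ (F : A → A) n x t → ∃[ s ] iterate (λ y → iterate F y n) x t ≡ iterate F x s
iterate-iterate F n x zero    = 0 , refl
iterate-iterate F n x (suc t) with iterate-iterate F n (iterate F x n) t
... | s , eq = n + s , trans eq (sym (iterate-+ F x n s))

000-reaches-0ᴸ : ∀ (F : Config L → Config L) n {i} → Widens (λ c → iterate F c n) i →
                 ∀ c j → block c j 3 ≡ replicate 3 0b → Basin F ｛ replicate L 0b ｝ c
000-reaches-0ᴸ {L} F n widens c j eq
  -- Each round gains one cell, so `L + L` rounds give a run long enough for `zeros-everywhere`.
  with widen-iterate (λ c → iterate F c n) widens (L + L) c j 0 (block⇒zeros c j 3 eq) | iterate-iterate F n c (L + L)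
... | j′ , z | s , is = s , trans (sym (zeros-everywhere _ j′ bound z)) is
  where
  bound : L + L ≤ 3 + (L + L + 0)
  bound = ≤-trans (m≤m+n (L + L) 0) (m≤n+m _ 3)

-- Configurations whose period divides 4

-- The letters rotate as the index decreases, so period 4 holds by computation and a shift of the
-- word is a rotation of its arguments.
word : Bit → Bit → Bit → Bit → ℕ → Bit
word a b c d zero    = a
word a b c d (suc n) = word b c d a n

-- The first component holds whenever the least period of the word divides L;
-- 4 ∣ L is not required.
Repeats : Bit → Bit → Bit → Bit → Config L → Set
Repeats {L} a b c d x =
  (∀ n → word a b c d (L + n) ≡ word a b c d n) × x ≡ tabulate (word a b c d ∘ toℕ)

private
  variable
    a b c d : Bit

-- Here and for the longer blocks below, removing one block brings `word` back to the same
-- arguments, so the periodicity proof for the tail serves unchanged.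
repeats₁ : ∀ k (x : Config L) → toList x ≡ (a List.∷ List.[]) ^ k → Repeats a a a a x
repeats₁ zero    []      _  = (λ _ → refl) , refl
repeats₁ (suc k) (_ ∷ x) eq with ∷-injective eq
... | refl , eq₁ with repeats₁ k x eq₁
... | period , refl = period , refl

repeats₂ : ∀ k (x : Config L) → toList x ≡ (a List.∷ b List.∷ List.[]) ^ k → Repeats a b a b x
repeats₂ zero    []          _  = (λ _ → refl) , refl
repeats₂ (suc k) (_ ∷ _ ∷ x) eq with ∷-injective eq
... | refl , eq₁ with ∷-injective eq₁
... | refl , eq₂ with repeats₂ k x eq₂
... | period , refl = period , refl

repeats₄ : ∀ k (x : Config L) → toList x ≡ (a List.∷ b List.∷ c List.∷ d List.∷ List.[]) ^ k →
           Repeats a b c d x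
repeats₄ zero    []                  _  = (λ _ → refl) , refl
repeats₄ (suc k) (_ ∷ _ ∷ _ ∷ _ ∷ x) eq with ∷-injective eq
... | refl , eq₁ with ∷-injective eq₁
... | refl , eq₂ with ∷-injective eq₂
... | refl , eq₃ with ∷-injective eq₃
... | refl , eq₄ with repeats₄ k x eq₄
... | period , refl = period , refl

periodic-% : ∀ {w : ℕ → A} m .{{_ : NonZero m}} → (∀ n → w (m + n) ≡ w n) → ∀ n → w (n % m) ≡ w n
periodic-% {w = w} m period n = sym (begin
  w n                     ≡⟨ cong w (m≡m%n+[m/n]*n n m) ⟩
  w (n % m + n / m * m)   ≡⟨ cong w (+-comm (n % m) (n / m * m)) ⟩
  w (n / m * m + n % m)   ≡⟨ multiple (n / m) ⟩
  w (n % m)               ∎)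
  where
  open ≡-Reasoning
  multiple : ∀ q → w (q * m + n % m) ≡ w (n % m)
  multiple zero    = refl
  multiple (suc q) = trans (cong w (+-assoc m (q * m) (n % m))) (trans (period _) (multiple q))

lookup-repeats : ∀ {x : Config L} → Repeats a b c d x → ∀ p → lookup x p ≡ word a b c d (toℕ p)
lookup-repeats (_ , refl) p = lookup∘tabulate _ p

-- Since `L` is a period of the word, the reduction of the index modulo `L` does not change the
-- letter.
lookup-repeats-⊕ : ∀ {x : Config L} → Repeats a b c d x → ∀ p k → lookup x (p ⊕ k) ≡ word a b c d (toℕ p + k)
lookup-repeats-⊕ {L = suc L} {x = x} r@(period , _) p k =
  trans (lookup-repeats r (p ⊕ k)) (trans (cong (word _ _ _ _) (toℕ-⊕ p k))
    (periodic-% (suc L) period (toℕ p + k)))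

-- The two left neighbours of cell `n` are read at `2 + n` and `3 + n`, which agree with `n - 2` and
-- `n - 1` modulo 4. Increasing `n` only rotates the letters.
word-step : ∀ (f : Rule) a b c d n → let w = word a b c d in
  f (w (2 + n)) (w (3 + n)) (w n) (w (1 + n)) (w (2 + n)) ≡
  word (f c d a b c) (f d a b c d) (f a b c d a) (f b c d a b) n
word-step f a b c d zero    = refl
word-step f a b c d (suc n) = word-step f b c d a n

cong₅ : ∀ (f : Rule) {a a′ b b′ c c′ d d′ e e′} → a ≡ a′ → b ≡ b′ → c ≡ c′ → d ≡ d′ → e ≡ e′ →
        f a b c d e ≡ f a′ b′ c′ d′ e′
cong₅ f refl refl refl refl refl = refl

global-repeats : ∀ f {x : Config L} → 2 ≤ L → Repeats a b c d x →
  Repeats (f c d a b c) (f d a b c d) (f a b c d a) (f b c d a b) (global f x)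
global-repeats {L = suc (suc m)} {a} {b} {c} {d} f {x} (s≤s (s≤s z≤n)) r@(period , _) =
  -- The period `L` passes to the image: each image letter is `f` of five letters of `w`, and each
  -- of these is unchanged by a shift by `L`.
  (λ n → trans (sym (word-step f a b c d (suc (suc m) + n)))
           (trans (cong₅ f (shifted 2 n) (shifted 3 n) (shifted 0 n) (shifted 1 n) (shifted 2 n))
                  (word-step f a b c d n)))
  , tabulate-cong (λ p → trans (cong₅ f (left₂ p) (left₁ p) (lookup-repeats r p) (right 1 p) (right 2 p))
                               (word-step f a b c d (toℕ p)))
  where
  w = word a b c d

  shifted : ∀ k n → w (k + (suc (suc m) + n)) ≡ w (k + n)
  shifted k n = trans (cong w (reorder k (suc (suc m)) n)) (period (k + n))
    where
    reorder : ∀ k l n → k + (l + n) ≡ l + (k + n)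
    reorder = solve-∀

  right : ∀ k p → lookup x (p ⊕ k) ≡ w (k + toℕ p)
  right k p = trans (lookup-repeats-⊕ r p k) (cong w (+-comm (toℕ p) k))

  -- w has period 4 definitionally, so p − 2 and p − 1 are shifted to p + 2 and p + 3.
  left₂ : ∀ p → lookup x (p ⊖ 2) ≡ w (2 + toℕ p)
  left₂ p = trans (lookup-repeats-⊕ r p m)
    (trans (cong w (reorder (toℕ p) m)) (period (2 + toℕ p)))
    where
    reorder : ∀ p m → 4 + (p + m) ≡ 2 + m + (2 + p)
    reorder = solve-∀

  left₁ : ∀ p → lookup x (p ⊖ 1) ≡ w (3 + toℕ p)
  left₁ p = trans (lookup-repeats-⊕ r p (suc m))
    (trans (cong w (reorder (toℕ p) m)) (period (3 + toℕ p)))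
    where
    reorder : ∀ p m → 4 + (p + suc m) ≡ 2 + m + (3 + p)
    reorder = solve-∀

word-const : ∀ a n → word a a a a n ≡ a
word-const a zero    = refl
word-const a (suc n) = word-const a n

repeats-const : ∀ {x : Config L} → Repeats a a a a x → x ≡ replicate L a
repeats-const {a = a} (_ , refl) = tabulate-const (word-const a ∘ toℕ)

replicate-repeats : Repeats {L} a a a a (replicate L a)
replicate-repeats {L = L} {a = a} =
  (λ n → trans (word-const a (L + n)) (sym (word-const a n))) ,
  sym (tabulate-const (word-const a ∘ toℕ))

repeats-cong : ∀ {x : Config L} {a′ b′ c′ d′} → a ≡ a′ → b ≡ b′ → c ≡ c′ → d ≡ d′ →
               Repeats a b c d x → Repeats a′ b′ c′ d′ x
repeats-cong refl refl refl refl r = r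

global-fixed : ∀ f → 2 ≤ L → f a a a a a ≡ a → global f (replicate L a) ≡ replicate L a
global-fixed f 2≤L fa = repeats-const
  (repeats-cong fa fa fa fa (global-repeats f 2≤L replicate-repeats))

-- Deciding membership in `E`

E? : ∀ L (c : Config L) → Dec (c ∈ E L)
E? L c =
  (¬? (2 ∣? L) ×-dec (toList c ∈? _))
  ⊎-dec (parametrized? 1 (λ p → 4 * p + 2) (λ p → ≤-trans (m≤n*m p 4) (m≤m+n (4 * p) 2)) (toList c ∈? _))
  ⊎-dec (parametrized? 2 (4 *_) (λ p → m≤n*m p 4) (toList c ∈? _))
  where
  -- A witness satisfies `p ≤ g p` and `L ≡ g p`, so searching the values up to `L` suffices.
  parametrized? : ∀ l (g : ℕ → ℕ) → (∀ p → p ≤ g p) → {P : Set} → Dec P →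
                  Dec (∃[ p ] l ≤ p × L ≡ g p × P)
  parametrized? l g p≤gp P? = map′
    (λ (p , _ , r) → p , r)
    (λ (p , l≤p , L≡gp , r) → p , s≤s (subst (p ≤_) (sym L≡gp) (p≤gp p)) , l≤p , L≡gp , r)
    (anyUpTo? (λ p → (l ≤? p) ×-dec (L ≟ g p) ×-dec P?) (suc L))

-- The words of `E` reach the all-ones configuration

module _ (f : Rule) (2≤L : 2 ≤ L)
  (f01010 : f 0b 1b 0b 1b 0b ≡ 1b) (f10101 : f 1b 0b 1b 0b 1b ≡ 1b)
  (f11001 : f 1b 1b 0b 0b 1b ≡ 1b) (f00110 : f 0b 0b 1b 1b 0b ≡ 1b)
  (f01100 : f 0b 1b 1b 0b 0b ≡ 0b) (f10011 : f 1b 0b 0b 1b 1b ≡ 0b)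
  where

  private
    step : ∀ {x : Config L} → Repeats a b c d x →
           Repeats (f c d a b c) (f d a b c d) (f a b c d a) (f b c d a b) (global f x)
    step = global-repeats f 2≤L

    back : ∀ {x : Config L} → global f x ∈ 𝓑 f L 1b → x ∈ 𝓑 f L 1b
    back {x} = basin-iterate (global f) ｛ replicate L 1b ｝ 1 x

    from-1 : ∀ {x : Config L} → Repeats 1b 1b 1b 1b x → x ∈ 𝓑 f L 1b
    from-1 r = 0 , sym (repeats-const r)

    from-10 : ∀ {x : Config L} → Repeats 1b 0b 1b 0b x → x ∈ 𝓑 f L 1b
    from-10 r = back (from-1 (repeats-cong f10101 f01010 f10101 f01010 (step r)))

    from-01 : ∀ {x : Config L} → Repeats 0b 1b 0b 1b x → x ∈ 𝓑 f L 1b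
    from-01 r = back (from-1 (repeats-cong f01010 f10101 f01010 f10101 (step r)))

    -- The five-cell neighbourhoods in a repetition of 1100 are the rotations 00110, 01100, 11001,
    -- 10011, on which `f` alternates between 1 and 0. The four phases thus go to the two phases of
    -- 10.
    from-1100 : ∀ {x : Config L} → Repeats 1b 1b 0b 0b x → x ∈ 𝓑 f L 1b
    from-1100 r = back (from-10 (repeats-cong f00110 f01100 f11001 f10011 (step r)))

    from-1001 : ∀ {x : Config L} → Repeats 1b 0b 0b 1b x → x ∈ 𝓑 f L 1b
    from-1001 r = back (from-01 (repeats-cong f01100 f11001 f10011 f00110 (step r)))

    from-0011 : ∀ {x : Config L} → Repeats 0b 0b 1b 1b x → x ∈ 𝓑 f L 1b
    from-0011 r = back (from-10 (repeats-cong f11001 f10011 f00110 f01100 (step r)))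

    from-0110 : ∀ {x : Config L} → Repeats 0b 1b 1b 0b x → x ∈ 𝓑 f L 1b
    from-0110 r = back (from-01 (repeats-cong f10011 f00110 f01100 f11001 (step r)))

  E⊆𝓑1 : E L ⊆ 𝓑 f L 1b
  E⊆𝓑1 (inj₁ (_ , here eq)) = from-1 (repeats₁ L _ eq)
  E⊆𝓑1 (inj₂ (inj₁ (_ , _ , _ , here eq))) = from-1 (repeats₁ L _ eq)
  E⊆𝓑1 (inj₂ (inj₁ (_ , _ , _ , there (here eq)))) = from-10 (repeats₂ (L / 2) _ eq)
  E⊆𝓑1 (inj₂ (inj₁ (_ , _ , _ , there (there (here eq))))) = from-01 (repeats₂ (L / 2) _ eq)
  E⊆𝓑1 (inj₂ (inj₂ (_ , _ , _ , here eq))) = from-1 (repeats₁ L _ eq)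
  E⊆𝓑1 (inj₂ (inj₂ (_ , _ , _ , there (here eq)))) = from-10 (repeats₂ (L / 2) _ eq)
  E⊆𝓑1 (inj₂ (inj₂ (_ , _ , _ , there (there (here eq))))) = from-01 (repeats₂ (L / 2) _ eq)
  E⊆𝓑1 (inj₂ (inj₂ (_ , _ , _ , there (there (there (here eq)))))) =
    from-1100 (repeats₄ (L / 4) _ eq)
  E⊆𝓑1 (inj₂ (inj₂ (_ , _ , _ , there (there (there (there (here eq))))))) =
    from-1001 (repeats₄ (L / 4) _ eq)
  E⊆𝓑1 (inj₂ (inj₂ (_ , _ , _ , there (there (there (there (there (here eq)))))))) =
    from-0011 (repeats₄ (L / 4) _ eq)
  E⊆𝓑1 (inj₂ (inj₂ (_ , _ , _ , there (there (there (there (there (there (here eq))))))))) =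
    from-0110 (repeats₄ (L / 4) _ eq)

-- The two basins and the consensus property

replicate-0≢1 : 1 ≤ L → replicate L 0b ≢ replicate L 1b
replicate-0≢1 (s≤s z≤n) ()

corollary8 : (f : Rule) (n₁ n₂ : ℕ) → 1 ≤ n₁ → 1 ≤ n₂ →
    (∀ L → 5 ≤ L → (c : Config L) → c ∉ E L →
    ∃[ j ] block (iterate (global f) c n₁) j 3 ≡ 0b ∷ 0b ∷ 0b ∷ []) →
    (∀ L → 5 ≤ L → ∃[ i ] ((c : Config L) (j : Fin L) →
    block c j 3 ≡ 0b ∷ 0b ∷ 0b ∷ [] →
    block (iterate (global f) c n₂) (i ⊕ toℕ j) 4 ≡ 0b ∷ 0b ∷ 0b ∷ 0b ∷ [])) →
    (f 0b 1b 0b 1b 0b ≡ 1b × f 1b 0b 1b 0b 1b ≡ 1b × f 1b 1b 1b 1b 1b ≡ 1b ×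
    f 1b 1b 0b 0b 1b ≡ 1b × f 0b 0b 1b 1b 0b ≡ 1b) →
    (f 0b 0b 0b 0b 0b ≡ 0b × f 0b 1b 1b 0b 0b ≡ 0b × f 1b 0b 0b 1b 1b ≡ 0b) →
    IsConsensus f × (∀ L → 5 ≤ L → 𝓑 f L 1b ≐ E L)
corollary8 f n₁ n₂ _ _ C1 C2 (f01010 , f10101 , f11111 , f11001 , f00110) (f00000 , f01100 , f10011) =
  consensus , λ L 5≤L → 𝓑1⊆E L 5≤L , E⊆𝓑 L 5≤L
  where
  2≤_ : ∀ {L} → 5 ≤ L → 2 ≤ L
  2≤ 5≤L = ≤-trans (s≤s (s≤s z≤n)) 5≤L

  fixed0 : ∀ L → 5 ≤ L → global f (replicate L 0b) ≡ replicate L 0b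
  fixed0 L 5≤L = global-fixed f (2≤ 5≤L) f00000

  fixed1 : ∀ L → 5 ≤ L → global f (replicate L 1b) ≡ replicate L 1b
  fixed1 L 5≤L = global-fixed f (2≤ 5≤L) f11111

  E⊆𝓑 : ∀ L → 5 ≤ L → E L ⊆ 𝓑 f L 1b
  E⊆𝓑 L 5≤L = E⊆𝓑1 f (2≤ 5≤L) f01010 f10101 f11001 f00110 f01100 f10011

  ∉E⇒𝓑0 : ∀ L → 5 ≤ L → ∀ {c} → c ∉ E L → c ∈ 𝓑 f L 0b
  ∉E⇒𝓑0 L 5≤L {c} c∉E with C1 L 5≤L c c∉E
  ... | j , 000-at-j = basin-iterate (global f) ｛ replicate L 0b ｝ n₁ c
    (000-reaches-0ᴸ (global f) n₂ (proj₂ (C2 L 5≤L)) (iterate (global f) c n₁) j 000-at-j)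

  𝓑1⊆E : ∀ L → 5 ≤ L → 𝓑 f L 1b ⊆ E L
  𝓑1⊆E L 5≤L {c} c∈𝓑1 with E? L c
  ... | yes c∈E = c∈E
  -- Outside `E` the configuration also reaches the all-zeros fixed point, which would then equal
  -- the all-ones one.
  ... | no  c∉E = contradiction
    (basins-disjoint (fixed0 L 5≤L) (fixed1 L 5≤L) (∉E⇒𝓑0 L 5≤L c∉E) c∈𝓑1)
    (replicate-0≢1 (≤-trans (s≤s z≤n) 5≤L))

  consensus : IsConsensus f
  consensus L 5≤L =
    fixed⇒attractor (fixed0 L 5≤L) , fixed⇒attractor (fixed1 L 5≤L) , only
    where
    only : ∀ X → IsAttractor (global f) X → X ≐ ｛ replicate L 0b ｝ ⊎ X ≐ ｛ replicate L 1b ｝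
    only X att with IsAttractor.nonempty att
    -- A single point of `X` suffices: it lies in one of the two basins, and that basin determines
    -- `X`.
    ... | c , c∈X with E? L c
    ... | yes c∈E = inj₂ (attractor-meets-basin att (fixed1 L 5≤L) c∈X (E⊆𝓑 L 5≤L c∈E))
    ... | no  c∉E = inj₁ (attractor-meets-basin att (fixed0 L 5≤L) c∈X (∉E⇒𝓑0 L 5≤L c∉E))
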